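{- Let $G$ and $H$ be finite simple connected graphs, each with at least two vertices. Let $(x_1,y_1),(x_2,y_2)\in V(G\boxtimes H)$, where $x_1\ne x_2$, $y_1\neq y_2$, $x_1x_2\notin E(G)$ and $y_1y_2\notin E(H)$. If $(x,y)\in V(G\boxtimes H)\setminus\left(N((x_1,y_1))\cup N((x_2,y_2))\right)$, then $(x,y)\in T_{G\boxtimes H}((x_1,y_1),(x_2,y_2))$.
   Context: $N(v)$ denotes the open neighborhood of a vertex $v$ (here in $G\boxtimes H$). The strong product $G\boxtimes H$ has vertex set $V(G)\times V(H)$; $(g_1,h_1)$ and $(g_2,h_2)$ are adjacent iff ($g_1g_2\in E(G)$ and $h_1=h_2$) or ($g_1=g_2$ and $h_1h_2\in E(H)$) or ($g_1g_2\in E(G)$ and $h_1h_2\in E(H)$). For two different non-adjacent vertices $u,v$ of a graph $F$, a tolled walk between $u$ and $v$ is a sequence of vertices $u,w_1,\dots,w_k,v$ with $k\ge 1$ such that consecutive vertices of $w_1,\dots,w_k$ are adjacent, $uw_i\in E(F)$ if and only if $i=1$, and $vw_i\in E(F)$ if and only if $i=k$. If $uv\in E(F)$, the only tolled walk between $u$ and $v$ is $u,v$; the only tolled walk from $v$ to itself is the single vertex $v$. The toll interval $T_F(u,v)$ is the set of all vertices of $F$ lying on some tolled walk between $u$ and $v$. -}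

module Defs where

open import Data.Fin.Base using (Fin; zero; suc; inject₁; fromℕ)
open import Data.Fin.Properties using (*↔×) renaming (_≟_ to _≟ᶠ_)
open import Data.List.Base using (List; []; _∷_; _∷ʳ_; tabulate)
open import Data.List.Membership.Propositional using () renaming (_∈_ to _∈ₗ_)
open import Data.Nat.Base using (ℕ; suc; _*_)
open import Data.Product.Base using (_×_; _,_; ∃-syntax)
open import Data.Product.Function.NonDependent.Propositional using (_×-↔_)
open import Data.Sum.Base using (_⊎_; inj₁; inj₂)
open import Function.Bundles using (_↔_; _⇔_)
open import Function.Properties.Inverse using (↔-sym; ↔-trans; ↔⇒↣)
open import Level using (0ℓ)
open import Relation.Binary.Construct.Closure.ReflexiveTransitive using (Star)
open import Relation.Binary.Core using (Rel)
open import Relation.Binary.Definitions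
  using (Decidable; DecidableEquality; Irreflexive; Symmetric)
open import Relation.Binary.PropositionalEquality.Core using (_≡_; _≢_; refl; sym)
open import Relation.Nullary.Decidable using (via-injection; _×-dec_; _⊎-dec_)
open import Relation.Nullary.Negation.Core using (¬_)
open import Relation.Unary using (Pred)

-- Adjacency is required to be decidable, so that case distinctions on the edge
-- set of a finite graph are available constructively.
record FiniteSimpleGraph : Set₁ where
  field
    V      : Set
    order  : ℕ
    enum   : V ↔ Fin order
    _~_    : Rel V 0ℓ
    ~-dec  : Decidable _~_
    ~-irr  : Irreflexive _≡_ _~_
    ~-sym  : Symmetric _~_

  infix 4 _~_

  _≟_ : DecidableEquality V
  _≟_ = via-injection (↔⇒↣ enum) _≟ᶠ_

  N : V → Pred V 0ℓ
  N v w = v ~ w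

  Connected : Set
  Connected = ∀ u v → Star _~_ u v

  -- TolledWalk u v ws: the list ws, endpoints included, is a tolled walk between
  -- u and v.  In the last constructor the inner vertices w₁, …, wₖ are indexed
  -- from zero and k is suc n, so w₁ is w zero and wₖ is w (fromℕ n).
  data TolledWalk : V → V → List V → Set where
    single      : ∀ {v} → TolledWalk v v (v ∷ [])
    edge        : ∀ {u v} → u ~ v → TolledWalk u v (u ∷ v ∷ [])
    nonadjacent : ∀ {u v} → u ≢ v → ¬ (u ~ v) →
                  ∀ {n} (w : Fin (suc n) → V) →
                  (∀ (i : Fin n) → w (inject₁ i) ~ w (suc i)) →
                  (∀ i → (u ~ w i) ⇔ (i ≡ zero)) →
                  (∀ i → (v ~ w i) ⇔ (i ≡ fromℕ n)) →
                  TolledWalk u v (u ∷ (tabulate w ∷ʳ v))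

  TollInterval : V → V → Pred V 0ℓ
  TollInterval u v x = ∃[ ws ] (TolledWalk u v ws × x ∈ₗ ws)

infixr 7 _⊠_

_⊠_ : FiniteSimpleGraph → FiniteSimpleGraph → FiniteSimpleGraph
G ⊠ H = record
  { V     = G.V × H.V
  ; order = G.order * H.order
  ; enum  = ↔-trans (G.enum ×-↔ H.enum) (↔-sym *↔×)
  ; _~_   = adj
  ; ~-dec = λ { (g₁ , h₁) (g₂ , h₂) →
      (G.~-dec g₁ g₂ ×-dec (h₁ H.≟ h₂)) ⊎-dec
      ((g₁ G.≟ g₂) ×-dec H.~-dec h₁ h₂) ⊎-dec
      (G.~-dec g₁ g₂ ×-dec H.~-dec h₁ h₂) }
  ; ~-irr = λ { refl (inj₁ (g , _))        → G.~-irr refl g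
              ; refl (inj₂ (inj₁ (_ , h))) → H.~-irr refl h
              ; refl (inj₂ (inj₂ (g , _))) → G.~-irr refl g }
  ; ~-sym = λ { (inj₁ (g , p))        → inj₁ (G.~-sym g , sym p)
              ; (inj₂ (inj₁ (p , h))) → inj₂ (inj₁ (sym p , H.~-sym h))
              ; (inj₂ (inj₂ (g , h))) → inj₂ (inj₂ (G.~-sym g , H.~-sym h)) }
  }
  where
  module G = FiniteSimpleGraph G
  module H = FiniteSimpleGraph H

  adj : Rel (G.V × H.V) 0ℓ
  adj (g₁ , h₁) (g₂ , h₂) =
    (g₁ G.~ g₂ × h₁ ≡ h₂) ⊎ (g₁ ≡ g₂ × h₁ H.~ h₂) ⊎ (g₁ G.~ g₂ × h₁ H.~ h₂)

{-# OPTIONS --safe #-}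

-- In the strong product N[(x₂ , y₂)] = N[x₂] × N[y₂].  Hence from a vertex (x , y)
-- outside it, say with x ∉ N[x₂], one reaches (x₁ , y₁) without meeting it: first
-- move inside the fibre over x to (x , y₁), then inside the fibre over y₁ ∉ N[y₂].
-- Thus a vertex outside N[u] ∪ N[v] has a walk to u avoiding N(v) and a walk to v
-- avoiding N(u); cut at the first neighbours of u and of v they form a tolled walk.
-- For u and v themselves, take any tolled walk, say the one through (x₁ , y₂).
module Submission where

open import Defs
open import Data.Empty using (⊥-elim)
open import Data.Fin.Base using (Fin; zero; suc; inject₁; fromℕ)
open import Data.Fin.Properties using (suc-injective)
open import Data.List.Base using (tabulate)
open import Data.List.Membership.Propositional using () renaming (_∈_ to _∈ₗ_)
open import Data.List.Membership.Propositional.Properties using (∈-++⁺ˡ; ∈-++⁺ʳ)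
open import Data.List.Relation.Unary.Any using (here; there)
open import Data.Nat.Base using (ℕ; suc; _≤_)
open import Data.Product.Base using (_×_; _,_; proj₁; proj₂)
open import Data.Sum.Base using (_⊎_; inj₁; inj₂; [_,_])
open import Data.Vec.Functional using (_∷_)
open import Function.Base using (_∘_)
open import Function.Bundles using (_⇔_; mk⇔; Equivalence)
open import Relation.Binary.Construct.Closure.ReflexiveTransitive using (Star; ε; _◅_; _◅◅_; gmap)
open import Relation.Binary.PropositionalEquality.Core using (_≡_; _≢_; refl; sym; cong)
open import Relation.Nullary.Decidable using (Dec; yes; no; _⊎-dec_)
open import Relation.Nullary.Negation.Core using (¬_)
open import Relation.Unary using (_∈_; _∉_; _∪_)
open FiniteSimpleGraph using (V; order; Connected; N; TollInterval)

module _ (F : FiniteSimpleGraph) where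
  open FiniteSimpleGraph F hiding (V; order; Connected; N; TollInterval)

  ClosedN : V F → V F → Set
  ClosedN c a = c ≡ a ⊎ c ~ a

  ClosedN-sym : ∀ {c a} → ClosedN c a → ClosedN a c
  ClosedN-sym = [ inj₁ ∘ sym , inj₂ ∘ ~-sym ]

  closedN? : ∀ c a → Dec (ClosedN c a)
  closedN? c a = (c ≟ a) ⊎-dec ~-dec c a

  -- Only the target of a step is tested, so the start of a walk of such steps is
  -- unconstrained.
  StepAvoiding : V F → V F → V F → Set
  StepAvoiding c a b = a ~ b × ¬ (c ~ b)

  tolledWalk-endpoints : ∀ {u v ws} → TolledWalk u v ws → u ∈ₗ ws × v ∈ₗ ws
  tolledWalk-endpoints single                    = here refl , here refl
  tolledWalk-endpoints (edge _)                  = here refl , there (here refl)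
  tolledWalk-endpoints (nonadjacent _ _ w _ _ _) =
    here refl , there (∈-++⁺ʳ (tabulate w) (here refl))

  tollInterval-endpoints : ∀ {u v a} → a ∈ TollInterval F u v →
                           u ∈ TollInterval F u v × v ∈ TollInterval F u v
  tollInterval-endpoints (ws , t , _) =
    (ws , t , proj₁ (tolledWalk-endpoints t)) , (ws , t , proj₂ (tolledWalk-endpoints t))

  -- A final segment, starting at a and passing through p, of the inner vertices of a
  -- would-be tolled walk from u to v that has not yet been extended back to N(u).
  record TolledEnd (u v p a : V F) : Set where
    field
      {size}  : ℕ
      inner   : Fin (suc size) → V F
      start   : inner zero ≡ a
      steps   : ∀ (i : Fin size) → inner (inject₁ i) ~ inner (suc i)
      end     : ∀ i → (v ~ inner i) ⇔ (i ≡ fromℕ size)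
      avoids  : ∀ i → ¬ (u ~ inner i)
      through : p ∈ₗ tabulate inner

  open TolledEnd

  ∷-steps : ∀ {n a b} (w : Fin (suc n) → V F) → w zero ≡ b → a ~ b →
            (∀ (i : Fin n) → w (inject₁ i) ~ w (suc i)) →
            ∀ (i : Fin (suc n)) → (a ∷ w) (inject₁ i) ~ (a ∷ w) (suc i)
  ∷-steps w refl a~b st zero    = a~b
  ∷-steps w refl a~b st (suc i) = st i

  -- Prepending shifts every index by one, `fromℕ n` included, so the only neighbour of `v` is still
  -- the last vertex.
  ∷-end : ∀ {n v a} (w : Fin (suc n) → V F) → ¬ (v ~ a) →
          (∀ i → (v ~ w i) ⇔ (i ≡ fromℕ n)) →
          ∀ i → (v ~ (a ∷ w) i) ⇔ (i ≡ fromℕ (suc n))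
  ∷-end w v≁a e zero    = mk⇔ (λ v~a → ⊥-elim (v≁a v~a)) (λ ())
  ∷-end w v≁a e (suc i) = mk⇔ (cong suc ∘ Equivalence.to (e i))
                              (Equivalence.from (e i) ∘ suc-injective)

  -- The marked vertex may change from `p` to `q`: it is reset to the new head while the part
  -- towards `v` is built, and kept while that part is extended towards `u`.
  tolledEnd-∷ : ∀ {u v p q a b} → a ~ b → ¬ (v ~ a) → ¬ (u ~ a) →
                (t : TolledEnd u v p b) → q ∈ₗ tabulate (a ∷ inner t) →
                TolledEnd u v q a
  tolledEnd-∷ {a = a} a~b v≁a u≁a t q∈ = record
    { inner   = a ∷ inner t
    ; start   = refl
    ; steps   = ∷-steps (inner t) (start t) a~b (steps t)
    ; end     = ∷-end (inner t) v≁a (end t)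
    ; avoids  = λ { zero → u≁a ; (suc i) → avoids t i }
    ; through = q∈
    }

  -- The walk is cut at its first vertex in N(v), possibly `a` itself. Vertices after `a` miss N(u)
  -- because they are targets of steps.
  tolledEnd-from : ∀ {u v a} → a ≢ v → ¬ (u ~ a) → Star (StepAvoiding u) a v →
                   TolledEnd u v a a
  tolledEnd-from a≢v u≁a ε = ⊥-elim (a≢v refl)
  tolledEnd-from {u} {v} {a} a≢v u≁a (_◅_ {j = b} (a~b , u≁b) bv) with ~-dec v a
  ... | yes v~a = record
    { inner   = λ (_ : Fin 1) → a
    ; start   = refl
    ; steps   = λ ()
    ; end     = λ { zero → mk⇔ (λ _ → refl) (λ _ → v~a) }
    ; avoids  = λ _ → u≁a
    ; through = here refl
    }
  ... | no v≁a = tolledEnd-∷ a~b v≁a u≁a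
    -- The walk cannot have reached `v` already: `b ≡ v` would put `a` into N(v).
    (tolledEnd-from (λ { refl → v≁a (~-sym a~b) }) u≁b bv) (here refl)

  -- The walk to `u` is reversed on the fly, each vertex being pushed in front of the segment, until
  -- the first neighbour of `u` becomes w₁. Since its steps avoid N(v), wₖ stays the only neighbour
  -- of `v`.
  tolledEnd⇒∈tollInterval : ∀ {u v p a} → u ≢ v → ¬ (u ~ v) →
                            a ≢ u → Star (StepAvoiding v) a u →
                            TolledEnd u v p a → p ∈ TollInterval F u v
  tolledEnd⇒∈tollInterval u≢v u≁v a≢u ε t = ⊥-elim (a≢u refl)
  tolledEnd⇒∈tollInterval {u} {v} {p} {a} u≢v u≁v a≢u (_◅_ {j = b} (a~b , v≁b) bu) t
    with ~-dec u b
  ... | yes u~b =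
    _ , nonadjacent u≢v u≁v (b ∷ inner t)
          (∷-steps (inner t) (start t) (~-sym a~b) (steps t))
          (λ { zero    → mk⇔ (λ _ → refl) (λ _ → u~b)
             ; (suc i) → mk⇔ (λ u~w → ⊥-elim (avoids t i u~w)) (λ ()) })
          (∷-end (inner t) v≁b (end t))
      , there (∈-++⁺ˡ (there (through t)))
  ... | no u≁b = tolledEnd⇒∈tollInterval u≢v u≁v b≢u bu
    (tolledEnd-∷ (~-sym a~b) v≁b u≁b t (there (through t)))
    where
    b≢u : b ≢ u
    -- If `b` were `u`, the head of the segment, `a`, would be a neighbour of `u`.
    b≢u refl = avoids t zero u~start
      where
      u~start : u ~ inner t zero
      u~start rewrite start t = ~-sym a~b

  avoidingWalks⇒∈tollInterval : ∀ {u v p} → ¬ ClosedN v u →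
    ¬ ClosedN u p → ¬ ClosedN v p →
    Star (StepAvoiding v) p u → Star (StepAvoiding u) p v →
    p ∈ TollInterval F u v
  avoidingWalks⇒∈tollInterval v∌u u∌p v∌p pu pv =
    tolledEnd⇒∈tollInterval
      (v∌u ∘ inj₁ ∘ sym) (v∌u ∘ inj₂ ∘ ~-sym) (u∌p ∘ inj₁ ∘ sym) pu
      (tolledEnd-from (v∌p ∘ inj₁ ∘ sym) (u∌p ∘ inj₂) pv)

module _ (G H : FiniteSimpleGraph) where
  private
    module G = FiniteSimpleGraph G
    module H = FiniteSimpleGraph H

  -- Equality and the three kinds of edges of `G ⊠ H` are exactly the four ways for both coordinates
  -- to be equal or adjacent.
  ClosedN-⊠⁻ : ∀ {c d x y} → ClosedN (G ⊠ H) (c , d) (x , y) →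
               ClosedN G c x × ClosedN H d y
  ClosedN-⊠⁻ (inj₁ refl)                     = inj₁ refl , inj₁ refl
  ClosedN-⊠⁻ (inj₂ (inj₁ (c~x , d≡y)))        = inj₂ c~x , inj₁ d≡y
  ClosedN-⊠⁻ (inj₂ (inj₂ (inj₁ (c≡x , d~y)))) = inj₁ c≡x , inj₂ d~y
  ClosedN-⊠⁻ (inj₂ (inj₂ (inj₂ (c~x , d~y)))) = inj₂ c~x , inj₂ d~y

  ClosedN-⊠⁺ : ∀ {c d x y} → ClosedN G c x → ClosedN H d y →
               ClosedN (G ⊠ H) (c , d) (x , y)
  ClosedN-⊠⁺ (inj₁ refl) (inj₁ refl) = inj₁ refl
  ClosedN-⊠⁺ (inj₂ c~x)  (inj₁ d≡y)  = inj₂ (inj₁ (c~x , d≡y))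
  ClosedN-⊠⁺ (inj₁ c≡x)  (inj₂ d~y)  = inj₂ (inj₂ (inj₁ (c≡x , d~y)))
  ClosedN-⊠⁺ (inj₂ c~x)  (inj₂ d~y)  = inj₂ (inj₂ (inj₂ (c~x , d~y)))

  -- The constant coordinate `y` alone keeps the whole fibre off N[(c , d)], so any walk of `G`
  -- lifts.
  fibreWalkˡ : ∀ {c d x x′ y} → ¬ ClosedN H d y → Star G._~_ x x′ →
               Star (StepAvoiding (G ⊠ H) (c , d)) (x , y) (x′ , y)
  fibreWalkˡ {y = y} d∌y = gmap (_, y) λ g →
    inj₁ (g , refl) , d∌y ∘ proj₂ ∘ ClosedN-⊠⁻ ∘ inj₂

  fibreWalkʳ : ∀ {c d x y y′} → ¬ ClosedN G c x → Star H._~_ y y′ →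
               Star (StepAvoiding (G ⊠ H) (c , d)) (x , y) (x , y′)
  fibreWalkʳ {x = x} c∌x = gmap (x ,_) λ h →
    inj₂ (inj₁ (refl , h)) , c∌x ∘ proj₁ ∘ ClosedN-⊠⁻ ∘ inj₂

  avoidingWalk-⊠ : Connected G → Connected H → ∀ {c d x y x′ y′} →
    ¬ ClosedN G c x′ → ¬ ClosedN H d y′ → ¬ ClosedN (G ⊠ H) (c , d) (x , y) →
    Star (StepAvoiding (G ⊠ H) (c , d)) (x , y) (x′ , y′)
  avoidingWalk-⊠ conG conH {c} {d} {x} {y} {x′} {y′} c∌x′ d∌y′ ∌xy
    with closedN? G c x | closedN? H d y
  -- The coordinate that witnesses the avoidance is frozen until the other one has reached its
  -- target, which then takes over as the witness.
  ... | no c∌x  | _       = fibreWalkʳ c∌x (conH y y′) ◅◅ fibreWalkˡ d∌y′ (conG x x′)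
  ... | yes _   | no d∌y  = fibreWalkˡ d∌y (conG x x′) ◅◅ fibreWalkʳ c∌x′ (conH y y′)
  ... | yes c∋x | yes d∋y = ⊥-elim (∌xy (ClosedN-⊠⁺ c∋x d∋y))

  ∈tollInterval-⊠ : Connected G → Connected H → ∀ {x₁ x₂ y₁ y₂ p} →
    ¬ ClosedN G x₁ x₂ → ¬ ClosedN H y₁ y₂ →
    ¬ ClosedN (G ⊠ H) (x₁ , y₁) p → ¬ ClosedN (G ⊠ H) (x₂ , y₂) p →
    p ∈ TollInterval (G ⊠ H) (x₁ , y₁) (x₂ , y₂)
  ∈tollInterval-⊠ conG conH x₁∌x₂ y₁∌y₂ u∌p v∌p =
    avoidingWalks⇒∈tollInterval (G ⊠ H) (x₂∌x₁ ∘ proj₁ ∘ ClosedN-⊠⁻) u∌p v∌p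
      (avoidingWalk-⊠ conG conH x₂∌x₁ y₂∌y₁ v∌p)
      (avoidingWalk-⊠ conG conH x₁∌x₂ y₁∌y₂ u∌p)
    where
    x₂∌x₁ = x₁∌x₂ ∘ ClosedN-sym G
    y₂∌y₁ = y₁∌y₂ ∘ ClosedN-sym H

  endpoints-∈tollInterval-⊠ : Connected G → Connected H → ∀ {x₁ x₂ y₁ y₂} →
    ¬ ClosedN G x₁ x₂ → ¬ ClosedN H y₁ y₂ →
    (x₁ , y₁) ∈ TollInterval (G ⊠ H) (x₁ , y₁) (x₂ , y₂) ×
    (x₂ , y₂) ∈ TollInterval (G ⊠ H) (x₁ , y₁) (x₂ , y₂)
  endpoints-∈tollInterval-⊠ conG conH {x₁} {y₂ = y₂} x₁∌x₂ y₁∌y₂ =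
    tollInterval-endpoints (G ⊠ H)
      -- This corner is kept out of N[(x₁ , y₁)] by its second coordinate and out of N[(x₂ , y₂)] by
      -- its first.
      (∈tollInterval-⊠ conG conH {p = x₁ , y₂} x₁∌x₂ y₁∌y₂
        (y₁∌y₂ ∘ proj₂ ∘ ClosedN-⊠⁻)
        (x₁∌x₂ ∘ ClosedN-sym G ∘ proj₁ ∘ ClosedN-⊠⁻))

corollary3p7 : (G H : FiniteSimpleGraph) →
    Connected G → Connected H →
    2 ≤ order G → 2 ≤ order H →
    (x₁ x₂ : V G) (y₁ y₂ : V H) →
    x₁ ≢ x₂ → y₁ ≢ y₂ →
    ¬ (FiniteSimpleGraph._~_ G x₁ x₂) → ¬ (FiniteSimpleGraph._~_ H y₁ y₂) →
    (x : V G) (y : V H) →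
    (x , y) ∉ N (G ⊠ H) (x₁ , y₁) ∪ N (G ⊠ H) (x₂ , y₂) →
    (x , y) ∈ TollInterval (G ⊠ H) (x₁ , y₁) (x₂ , y₂)
corollary3p7 G H conG conH _ _ x₁ x₂ y₁ y₂ x₁≢x₂ y₁≢y₂ x₁≁x₂ y₁≁y₂ x y p∉N
  -- `p∉N` concerns open neighbourhoods, so it still allows `(x , y)` to be an endpoint; away from
  -- both endpoints it gives the closed version.
  with P._≟_ (x₁ , y₁) (x , y) | P._≟_ (x₂ , y₂) (x , y)
  where module P = FiniteSimpleGraph (G ⊠ H)
... | no u≢p   | no v≢p   = ∈tollInterval-⊠ G H conG conH
  [ x₁≢x₂ , x₁≁x₂ ] [ y₁≢y₂ , y₁≁y₂ ] [ u≢p , p∉N ∘ inj₁ ] [ v≢p , p∉N ∘ inj₂ ]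
... | yes refl | _        = proj₁ (endpoints-∈tollInterval-⊠ G H conG conH
  [ x₁≢x₂ , x₁≁x₂ ] [ y₁≢y₂ , y₁≁y₂ ])
... | no _     | yes refl = proj₂ (endpoints-∈tollInterval-⊠ G H conG conH
  [ x₁≢x₂ , x₁≁x₂ ] [ y₁≢y₂ , y₁≁y₂ ])
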